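{- There exists an absolute constant $c>0$ such that for every positive integer $n$ there exists a graph $G$ with exactly $n$ vertices that is a Hasse diagram and whose chromatic number satisfies $\chi(G)\geq c\,n^{1/4}$.
   Context: Given a finite partially ordered set $(P,<)$, its Hasse diagram (cover graph) is the undirected graph on vertex set $P$ in which $x$ and $y$ are joined by an edge if $x<y$ and there is no $z\in P$ with $x<z<y$. A graph is called a Hasse diagram if it is the Hasse diagram of some finite partially ordered set. $\chi(G)$ denotes the chromatic number of $G$. -}

module Defs where

open import Data.Fin using (Fin)
open import Data.Integer using (+_)
open import Data.Nat as ℕ using (ℕ)
open import Data.Product using (Σ; Σ-syntax; _×_; ∃-syntax)
open import Data.Rational using (ℚ; _/_; _*_; _≤_; +-*-rawSemiring)
open import Data.Sum using (_⊎_)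
open import Function.Bundles using (_⇔_; _↔_)
open import Relation.Binary.Core using (Rel)
open import Relation.Binary.Definitions using (Symmetric; Irreflexive)
open import Relation.Binary.Structures using (IsStrictPartialOrder)
open import Relation.Binary.PropositionalEquality using (_≡_; _≢_)
open import Relation.Nullary using (¬_)
open import Level using (0ℓ)

open import Algebra.Definitions.RawSemiring +-*-rawSemiring using (_^_)

record FiniteGraph : Set₁ where
  field
    Vertex      : Set
    Adj         : Rel Vertex 0ℓ
    symmetric   : Symmetric Adj
    irreflexive : Irreflexive _≡_ Adj
    order       : ℕ
    enumeration : Vertex ↔ Fin order

module _ {A : Set} where

  Covers : Rel A 0ℓ → Rel A 0ℓ
  Covers _<_ x y = x < y × ¬ (∃[ z ] (x < z × z < y))

  HasseAdj : Rel A 0ℓ → Rel A 0ℓ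
  HasseAdj _<_ x y = Covers _<_ x y ⊎ Covers _<_ y x

module _ (G : FiniteGraph) where
  open FiniteGraph G

  -- The Hasse diagram of a poset has the poset itself as vertex set, so the
  -- order is taken on Vertex, which is finite.
  IsHasseDiagram : Set₁
  IsHasseDiagram =
    Σ (Rel Vertex 0ℓ) λ _<_ →
      IsStrictPartialOrder _≡_ _<_ × (∀ x y → Adj x y ⇔ HasseAdj _<_ x y)

  Colourable : ℕ → Set
  Colourable k =
    Σ[ colour ∈ (Vertex → Fin k) ] (∀ x y → Adj x y → colour x ≢ colour y)

  record IsChromaticNumber (χ : ℕ) : Set where
    field
      colourable : Colourable χ
      minimal    : ∀ k → Colourable k → χ ℕ.≤ k

-- The real inequality c · n^(1/4) ≤ k, for c ≥ 0. Both sides are nonnegative,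
-- and x ↦ x⁴ is strictly increasing on nonnegative reals, so it is expressed
-- by comparing fourth powers. A rational c loses nothing: below a positive
-- real constant there is a positive rational one.
_·_^¼≤_ : ℚ → ℕ → ℕ → Set
c · n ^¼≤ k = (c ^ 4) * (+ n / 1) ≤ (+ k / 1) ^ 4

{-# OPTIONS --safe #-}

-- The vertices are incidences (x , a , b), standing for the point of abscissa x
-- on the line y = a x + b.  There is an arrow from an incidence to every
-- incidence further right on a steeper line that passes through a point of the
-- first line.  A path of at least two arrows is a strictly convex chain, so it
-- ends strictly above its first line and is parallel to no arrow: the arrows are
-- exactly the covers of their transitive closure.  In an independent set,
-- incidences that are steepest at their point are determined by the point, and
-- the others are determined by their line, because an incidence to the left on
-- the same line would have an arrow to any steeper one.  With x , a < m and
-- b < m² a colour class therefore has at most 3 m³ of the m⁴ incidences.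
module Submission where

open import Defs
open import Algebra.Bundles using (CommutativeRing)
import Algebra.Properties.CommutativeSemiring.Exp as Exp
open import Data.Fin using (Fin; toℕ; fromℕ<; inject≤; finToFun; funToFin)
open import Data.Fin.Properties
  using (toℕ-injective; toℕ<n; toℕ-fromℕ<; inject≤-injective; finToFun-funToFin;
         any?; all?; injective⇒≤; +↔⊎; *↔×)
  renaming (_≟_ to _≟ᶠ_)
open import Data.Integer as ℤ using (+_)
import Data.Integer.Properties as ℤ
open import Data.Nat using (ℕ; zero; suc; NonZero; z≤n; s≤s; _+_; _*_; _^_; _≤_)
  renaming (_<_ to _<ᴺ_)
open import Data.Nat.Coprimality using (1-coprimeTo) renaming (sym to coprime-sym)
open import Data.Nat.Properties as ℕ using (_<?_; _≤?_; module ≤-Reasoning)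
open import Data.Nat.Tactic.RingSolver using (solve-∀)
open import Data.Product using (Σ-syntax; ∃; ∃-syntax; _×_; _,_; proj₁; proj₂)
open import Data.Product.Function.NonDependent.Propositional using (_×-↔_)
open import Data.Rational using (ℚ; 0ℚ; _<_; mkℚ; _/_; *≤*)
import Data.Rational as ℚ
import Data.Rational.Properties as ℚ
open import Data.Sum as Sum using (_⊎_; inj₁; inj₂; swap)
open import Data.Sum.Function.Propositional using (_⊎-↔_)
open import Data.Sum.Properties using (inj₁-injective; inj₂-injective)
open import Function.Base using (_∘_; _on_)
open import Function.Bundles using (_↔_; mk⇔; Inverse)
open import Function.Construct.Composition using (_↔-∘_)
open import Function.Construct.Identity using (↔-id)
open import Function.Construct.Symmetry using (↔-sym)
open import Function.Definitions using (Injective)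
open import Level using (0ℓ)
open import Relation.Binary.Construct.Closure.Transitive using (TransClosure; [_]; _∷_; _++_)
open import Relation.Binary.Core using (Rel)
open import Relation.Binary.Definitions using (Transitive) renaming (Decidable to Decidable₂)
open import Relation.Binary.PropositionalEquality
open import Relation.Binary.Structures using (IsStrictPartialOrder)
open import Relation.Nullary using (¬_; Dec; yes; no; ¬?; contradiction)
open import Relation.Nullary.Decidable using (map′; _×-dec_; _⊎-dec_; _→-dec_)
open import Relation.Unary using (Decidable)
open import Algebra.Definitions.RawSemiring ℚ.+-*-rawSemiring using () renaming (_^_ to _^ℚ_)

open Inverse using (to; from; strictlyInverseʳ)

-- Existence of the chromatic number, by finite search

least : {P : ℕ → Set} → Decidable P → ∀ n → P n → ∃[ m ] (P m × (∀ k → P k → m ≤ k))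
least P? zero    p = 0 , p , λ _ _ → z≤n
least P? (suc n) p with P? 0
... | yes p₀ = 0 , p₀ , λ _ _ → z≤n
... | no ¬p₀ with least (P? ∘ suc) n p
...   | m , pₘ , min = suc m , pₘ , λ where
  zero    p₀ → contradiction p₀ ¬p₀
  (suc k) pₖ → s≤s (min k pₖ)

↔⇒injective : {A B : Set} (e : A ↔ B) → Injective _≡_ _≡_ (to e)
↔⇒injective e {x} {y} eq =
  trans (sym (strictlyInverseʳ e x)) (trans (cong (from e) eq) (strictlyInverseʳ e y))

module _ (G : FiniteGraph) where
  open FiniteGraph G

  colourable-order : Colourable G order
  colourable-order = to enumeration , λ x y xy eq →
    irreflexive (↔⇒injective enumeration eq) xy

  module _ (adj? : Decidable₂ Adj) where

    -- A colouring of the enumerated vertices is coded by one element of `Fin (k ^ order)`, so all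
    -- candidates can be tried in turn.
    colourable? : Decidable (Colourable G)
    colourable? k = map′ decode encode (any? λ j → all? λ s → all? λ t →
      adj? (from enumeration s) (from enumeration t) →-dec ¬? (finToFun {k} j s ≟ᶠ finToFun j t))
      where
      Proper : Fin (k ^ order) → Set
      Proper j = ∀ s t → Adj (from enumeration s) (from enumeration t) →
        finToFun {k} {order} j s ≢ finToFun j t

      decode : ∃ Proper → Colourable G k
      decode (j , proper) = finToFun j ∘ to enumeration , λ x y xy → proper _ _
        (subst₂ Adj (sym (strictlyInverseʳ enumeration x)) (sym (strictlyInverseʳ enumeration y)) xy)

      encode : Colourable G k → ∃ Proper
      encode (colour , proper) = funToFin c , λ s t st eq → proper _ _ st
        (trans (sym (finToFun-funToFin c s)) (trans eq (finToFun-funToFin c t)))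
        where
        c : Fin order → Fin k
        c = colour ∘ from enumeration

    chromaticNumber : ∃ (IsChromaticNumber G)
    chromaticNumber with least colourable? order colourable-order
    ... | χ , colourable , minimal = χ , record { colourable = colourable ; minimal = minimal }

-- Incidences of points and lines, and convex chains

Incidence : ℕ → Set
Incidence m = Fin m × Fin m × Fin (m * m)

module _ {m : ℕ} where

  abscissa slope : Incidence m → ℕ
  abscissa (x , _ , _) = toℕ x
  slope    (_ , a , _) = toℕ a

  height : Incidence m → ℕ → ℕ
  height (_ , a , b) x = toℕ a * x + toℕ b

  ordinate : Incidence m → ℕ
  ordinate p = height p (abscissa p)

  -- Since `a * x ≤ m * m` and `b < m * m`, the points lie in a finite grid, so they can be counted.
  ordinate< : ∀ p → ordinate p <ᴺ m * m + m * m
  ordinate< p@(x , a , b) =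
    ℕ.+-mono-≤-< (ℕ.*-mono-≤ (ℕ.<⇒≤ (toℕ<n a)) (ℕ.<⇒≤ (toℕ<n x))) (toℕ<n b)

  infix 4 _⟶_ _≺_
  infixr 4 _⟶?_

  _⟶_ : Rel (Incidence m) 0ℓ
  p ⟶ q = abscissa p <ᴺ abscissa q × slope p <ᴺ slope q × height p (abscissa q) ≡ ordinate q

  _⟶?_ : Decidable₂ _⟶_
  p ⟶? q = abscissa p <? abscissa q ×-dec slope p <? slope q ×-dec
    height p (abscissa q) ℕ.≟ ordinate q

  -- Arrows need not compose to arrows. Relaxing "on the line" to "on or above the line" gives a
  -- transitive relation, hence an invariant of paths.
  _≺_ : Rel (Incidence m) 0ℓ
  p ≺ q = abscissa p <ᴺ abscissa q × slope p <ᴺ slope q × height p (abscissa q) ≤ ordinate q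

  ⟶⇒≺ : ∀ {p q} → p ⟶ q → p ≺ q
  ⟶⇒≺ (x< , a< , y≡) = x< , a< , ℕ.≤-reflexive y≡

  -- Writing `x′` as `suc x + d`, each line rises by its slope times the positive gap `suc d`, and
  -- the steeper one rises more.
  steeper-diverges : ∀ p q {x x′} → slope p <ᴺ slope q → x <ᴺ x′ →
    height p x ≤ height q x → height p x′ <ᴺ height q x′
  steeper-diverges (_ , a , b) (_ , a′ , b′) {x} a<a′ x<x′ h
    with ℕ.m≤n⇒∃[o]m+o≡n x<x′
  ... | d , refl = subst₂ _<ᴺ_ (shift (toℕ a) (toℕ b) x d) (shift (toℕ a′) (toℕ b′) x d)
    (ℕ.+-mono-≤-< h (ℕ.*-monoˡ-< (suc d) a<a′))
    where
    shift : ∀ a b x d → (a * x + b) + a * suc d ≡ a * (suc x + d) + b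
    shift = solve-∀

  -- The line of `q` is at or above that of `p` at `q`, hence strictly above it at `r`, and `r` is
  -- on or above the line of `q`.
  ≺-overtakes : ∀ {p q r} → p ≺ q → q ≺ r → height p (abscissa r) <ᴺ ordinate r
  ≺-overtakes {p} {q} (_ , a< , y≤) (x<′ , _ , y≤′) =
    ℕ.<-≤-trans (steeper-diverges p q a< x<′ y≤) y≤′

  ≺-trans : Transitive _≺_
  ≺-trans p≺q@(x< , a< , _) q≺r@(x<′ , a<′ , _) =
    ℕ.<-trans x< x<′ , ℕ.<-trans a< a<′ , ℕ.<⇒≤ (≺-overtakes p≺q q≺r)

  -- The order generated by the arrows, and its covers

  module _ {V : Set} (f : V → Incidence m) where

    infix 4 _⟶ᵛ_ _⟶⁺_

    -- Paths run through `V` only, so the order makes sense for any selection of incidences, not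
    -- just for all of them.
    _⟶ᵛ_ _⟶⁺_ : Rel V 0ℓ
    _⟶ᵛ_ = _⟶_ on f
    _⟶⁺_ = TransClosure _⟶ᵛ_

    ⟶⁺⇒≺ : ∀ {v w} → v ⟶⁺ w → f v ≺ f w
    ⟶⁺⇒≺ [ e ]   = ⟶⇒≺ e
    ⟶⁺⇒≺ (e ∷ p) = ≺-trans (⟶⇒≺ e) (⟶⁺⇒≺ p)

    ⟶⁺-isStrictPartialOrder : IsStrictPartialOrder _≡_ _⟶⁺_
    ⟶⁺-isStrictPartialOrder = record
      { isEquivalence = isEquivalence
      ; irrefl        = λ { refl p → ℕ.<-irrefl refl (proj₁ (⟶⁺⇒≺ p)) }
      ; trans         = _++_
      ; <-resp-≈      = subst (_ ⟶⁺_) , subst (_⟶⁺ _)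
      }

    -- An intermediate vertex would put `w` strictly above the line of `v`, but the arrow puts it on
    -- that line.
    ⟶⇒covers : ∀ {v w} → v ⟶ᵛ w → Covers _⟶⁺_ v w
    ⟶⇒covers e@(_ , _ , y≡) = [ e ] , λ (_ , p , q) →
      ℕ.<-irrefl y≡ (≺-overtakes (⟶⁺⇒≺ p) (⟶⁺⇒≺ q))

    covers⇒⟶ : ∀ {v w} → Covers _⟶⁺_ v w → v ⟶ᵛ w
    covers⇒⟶ ([ e ] , _)   = e
    covers⇒⟶ (e ∷ p , ¬z) = contradiction (_ , [ e ] , p) ¬z

  -- The graph and the size of its colour classes

  module _ {n : ℕ} (f : Fin n → Incidence m) where

    incidenceGraph : FiniteGraph
    incidenceGraph = record
      { Vertex      = Fin n
      ; Adj         = λ v w → f v ⟶ f w ⊎ f w ⟶ f v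
      ; symmetric   = swap
      ; irreflexive = λ { refl (inj₁ (x< , _)) → ℕ.<-irrefl refl x<
                        ; refl (inj₂ (x< , _)) → ℕ.<-irrefl refl x< }
      ; order       = n
      ; enumeration = ↔-id (Fin n)
      }

    incidenceGraph-adj? : Decidable₂ (FiniteGraph.Adj incidenceGraph)
    incidenceGraph-adj? v w = (f v ⟶? f w) ⊎-dec (f w ⟶? f v)

    incidenceGraph-isHasseDiagram : IsHasseDiagram incidenceGraph
    incidenceGraph-isHasseDiagram = _⟶⁺_ f , ⟶⁺-isStrictPartialOrder f , λ v w →
      mk⇔ (Sum.map (⟶⇒covers f) (⟶⇒covers f)) (Sum.map (covers⇒⟶ f) (covers⇒⟶ f))

    module _ (f-injective : Injective _≡_ _≡_ f) {χ : ℕ}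
             (colouring : Colourable incidenceGraph χ) where

      private
        colour = proj₁ colouring

        Line Point : Set
        Line  = Fin m × Fin (m * m)
        Point = Fin m × Fin (m * m + m * m)

        line : Fin n → Line
        line = proj₂ ∘ f

        point : Fin n → Point
        point v = proj₁ (f v) , fromℕ< (ordinate< (f v))

        point-ordinate : ∀ {v w} → point v ≡ point w → ordinate (f v) ≡ ordinate (f w)
        point-ordinate {v} {w} eq = trans (sym (toℕ-fromℕ< (ordinate< (f v))))
          (trans (cong (toℕ ∘ proj₂) eq) (toℕ-fromℕ< (ordinate< (f w))))

        Steeper : Fin n → Fin n → Set
        Steeper v w = colour v ≡ colour w × abscissa (f v) ≡ abscissa (f w) ×
          ordinate (f v) ≡ ordinate (f w) × slope (f v) <ᴺ slope (f w)

        steeper? : ∀ v → Dec (∃ (Steeper v))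
        steeper? v = any? λ w → (colour v ≟ᶠ colour w) ×-dec
          (abscissa (f v) ℕ.≟ abscissa (f w)) ×-dec
          (ordinate (f v) ℕ.≟ ordinate (f w)) ×-dec (slope (f v) <? slope (f w))

        class : Fin n → Line ⊎ Point
        class v with steeper? v
        ... | yes _ = inj₁ (line v)
        ... | no  _ = inj₂ (point v)

        -- The steeper `u` passes through the point of `w`, which is on the line of `v`. Were `w` to
        -- the right of `v`, there would be an arrow from `v` to `u`, two vertices of one colour.
        collinear-not-left : ∀ {v w} → colour v ≡ colour w → line v ≡ line w →
          ∃ (Steeper w) → ¬ (abscissa (f v) <ᴺ abscissa (f w))
        collinear-not-left {v} {w} cvw ℓ≡ (u , cwu , x≡ , y≡ , a<) x< =
          proj₂ colouring v u (inj₁ (subst (_ <ᴺ_) x≡ x< ,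
            subst (_<ᴺ _) (cong (toℕ ∘ proj₁) (sym ℓ≡)) a< , height≡)) (trans cvw cwu)
          where
          height≡ : height (f v) (abscissa (f u)) ≡ ordinate (f u)
          height≡ = begin
            height (f v) (abscissa (f u)) ≡⟨ cong (height (f v)) x≡ ⟨
            height (f v) (abscissa (f w)) ≡⟨ cong (λ (a , b) → toℕ a * abscissa (f w) + toℕ b) ℓ≡ ⟩
            ordinate (f w)                ≡⟨ y≡ ⟩
            ordinate (f u)                ∎
            where open ≡-Reasoning

        collinear⇒≡ : ∀ {v w} → colour v ≡ colour w → line v ≡ line w →
          ∃ (Steeper v) → ∃ (Steeper w) → v ≡ w
        collinear⇒≡ c≡ ℓ≡ sv sw = f-injective (cong₂ _,_ (toℕ-injective (ℕ.≤-antisym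
          (ℕ.≮⇒≥ (collinear-not-left (sym c≡) (sym ℓ≡) sv))
          (ℕ.≮⇒≥ (collinear-not-left c≡ ℓ≡ sw)))) ℓ≡)

        -- Neither vertex is steeper than the other, so the slopes agree; slope and point together
        -- fix the intercept.
        concurrent⇒≡ : ∀ {v w} → colour v ≡ colour w → point v ≡ point w →
          ¬ ∃ (Steeper v) → ¬ ∃ (Steeper w) → v ≡ w
        concurrent⇒≡ {v} {w} c≡ p≡ ¬sv ¬sw = f-injective (cong₂ _,_ x≡ (cong₂ _,_ a≡ b≡))
          where
          x≡ = cong proj₁ p≡
          y≡ = point-ordinate p≡
          a≡ : proj₁ (line v) ≡ proj₁ (line w)
          a≡ = toℕ-injective (ℕ.≤-antisym
            (ℕ.≮⇒≥ λ a< → ¬sw (v , sym c≡ , cong toℕ (sym x≡) , sym y≡ , a<))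
            (ℕ.≮⇒≥ λ a< → ¬sv (w , c≡ , cong toℕ x≡ , y≡ , a<)))
          b≡ : proj₂ (line v) ≡ proj₂ (line w)
          b≡ = toℕ-injective (ℕ.+-cancelˡ-≡ (slope (f v) * abscissa (f v)) _ _
            (trans y≡ (cong₂ (λ a x → toℕ a * toℕ x + toℕ (proj₂ (line w))) (sym a≡) (sym x≡))))

        class-injective : ∀ v w → colour v ≡ colour w → class v ≡ class w → v ≡ w
        class-injective v w c≡ eq with steeper? v | steeper? w
        ... | yes sv | yes sw = collinear⇒≡ c≡ (inj₁-injective eq) sv sw
        ... | no ¬sv | no ¬sw = concurrent⇒≡ c≡ (inj₂-injective eq) ¬sv ¬sw

        classes : Fin (χ * (m * (m * m) + m * (m * m + m * m))) ↔ (Fin χ × (Line ⊎ Point))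
        classes = (↔-id _ ×-↔ ((*↔× ⊎-↔ *↔×) ↔-∘ +↔⊎)) ↔-∘ *↔×

      -- Colour and class determine the vertex. The summands count the `m * (m * m)` lines and the
      -- twice as many grid points, for each colour.
      vertices≤ : n ≤ χ * (m * (m * m) + m * (m * m + m * m))
      vertices≤ = injective⇒≤ {f = λ v → from classes (colour v , class v)} λ {v} {w} eq →
        let eq′ = ↔⇒injective (↔-sym classes) eq
        in class-injective v w (cong proj₁ eq′) (cong proj₂ eq′)

-- Arithmetic of fourth powers

fourth-power : ∀ m → m ^ 4 ≡ m * (m * (m * m))
fourth-power m = cong (λ k → m * (m * (m * k))) (ℕ.*-identityʳ m)

Fin⁴↔Incidence : ∀ m → Fin (m ^ 4) ↔ Incidence m
Fin⁴↔Incidence m = subst (λ k → Fin k ↔ Incidence m) (sym (fourth-power m))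
  ((↔-id _ ×-↔ *↔×) ↔-∘ *↔×)

-- Induction on `n`, raising the base by one only when the old fourth power is exceeded. That at
-- most doubles the base, whence the factor 16.
near-fourth-power : ∀ n → .{{NonZero n}} → ∃[ m ] (n ≤ suc m ^ 4 × suc m ^ 4 ≤ 16 * n)
near-fourth-power 1 = 0 , s≤s z≤n , s≤s z≤n
near-fourth-power (suc n@(suc _)) with near-fourth-power n
... | m , n≤ , ≤16n with suc n ≤? suc m ^ 4
...   | yes n< = m , n< , ℕ.≤-trans ≤16n (ℕ.*-monoʳ-≤ 16 (ℕ.n≤1+n n))
...   | no  n≮ = suc m , ℕ.≤-trans (s≤s n≤) (ℕ.^-monoˡ-< 4 (ℕ.n<1+n (suc m))) , (begin
  suc (suc m) ^ 4     ≤⟨ ℕ.^-monoˡ-≤ 4 (s≤s (ℕ.m≤n+m (suc m) m)) ⟩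
  (suc m + suc m) ^ 4 ≡⟨ cong (λ k → (suc m + k) ^ 4) (ℕ.+-identityʳ (suc m)) ⟨
  (2 * suc m) ^ 4     ≡⟨ ℕ-Exp.^-distrib-* 2 (suc m) 4 ⟩
  16 * suc m ^ 4      ≤⟨ ℕ.*-monoʳ-≤ 16 (ℕ.<⇒≤ (ℕ.≰⇒> n≮)) ⟩
  16 * suc n          ∎)
  where
  open ≤-Reasoning
  module ℕ-Exp = Exp ℕ.+-*-commutativeSemiring

order≤χ⁴ : ∀ {n χ} m → suc m ^ 4 ≤ 16 * n → n ≤ suc m ^ 4 →
  n ≤ χ * (suc m * (suc m * suc m) + suc m * (suc m * suc m + suc m * suc m)) →
  n ≤ (48 * χ) ^ 4
order≤χ⁴ {n} {χ} m ≤16n n≤ n≤3χm³ = ℕ.≤-trans n≤ (ℕ.^-monoˡ-≤ 4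
  -- Cancelling the cube, nonzero because `k` is a successor, leaves `k ≤ 48 * χ`.
  (ℕ.*-cancelʳ-≤ k (48 * χ) (k * (k * k)) (begin
    k * (k * (k * k))                                    ≡⟨ fourth-power k ⟨
    k ^ 4                                                ≤⟨ ≤16n ⟩
    16 * n                                               ≤⟨ ℕ.*-monoʳ-≤ 16 n≤3χm³ ⟩
    16 * (χ * (k * (k * k) + k * (k * k + k * k)))       ≡⟨ collect χ k ⟩
    48 * χ * (k * (k * k))                               ∎)))
  where
  open ≤-Reasoning
  k = suc m
  collect : ∀ χ k → 16 * (χ * (k * (k * k) + k * (k * k + k * k))) ≡ 48 * χ * (k * (k * k))
  collect = solve-∀

-- Passage to the rationals

/1-mkℚ : ∀ n → + n / 1 ≡ mkℚ (+ n) 0 (coprime-sym (1-coprimeTo n))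
/1-mkℚ n = ℚ.normalize-coprime (coprime-sym (1-coprimeTo n))

/1-homo-* : ∀ m n → + (m * n) / 1 ≡ (+ m / 1) ℚ.* (+ n / 1)
-- Division by 1 normalises through a gcd that is stuck on a variable; the reduced form exposes the
-- numerators.
/1-homo-* m n rewrite /1-mkℚ m | /1-mkℚ n = cong (_/ 1) (ℤ.pos-* m n)

/1-homo-^ : ∀ m k → + (m ^ k) / 1 ≡ (+ m / 1) ^ℚ k
/1-homo-^ m zero    = refl
/1-homo-^ m (suc k) = trans (/1-homo-* m (m ^ k)) (cong ((+ m / 1) ℚ.*_) (/1-homo-^ m k))

/1-mono-≤ : ∀ {m n} → m ≤ n → + m / 1 ℚ.≤ + n / 1
/1-mono-≤ {m} {n} m≤n rewrite /1-mkℚ m | /1-mkℚ n =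
  *≤* (ℤ.*-monoʳ-≤-nonNeg (+ 1) (ℤ.+≤+ m≤n))

-- Here 48 is 16, lost in rounding `n` up to a fourth power, times 3, from the bound of three cubes
-- per colour.
1/48 : ℚ
1/48 = + 1 / 48

order≤⇒^¼≤ : ∀ {n χ} → n ≤ (48 * χ) ^ 4 → 1/48 · n ^¼≤ χ
order≤⇒^¼≤ {n} {χ} n≤ = begin
  1/48 ^ℚ 4 ℚ.* (+ n / 1)               ≤⟨ ℚ.*-monoˡ-≤-nonNeg (1/48 ^ℚ 4) (/1-mono-≤ n≤) ⟩
  1/48 ^ℚ 4 ℚ.* (+ ((48 * χ) ^ 4) / 1)  ≡⟨ cong (1/48 ^ℚ 4 ℚ.*_) (/1-homo-^ (48 * χ) 4) ⟩
  1/48 ^ℚ 4 ℚ.* (+ (48 * χ) / 1) ^ℚ 4   ≡⟨ ^-distrib-* 1/48 (+ (48 * χ) / 1) 4 ⟨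
  (1/48 ℚ.* (+ (48 * χ) / 1)) ^ℚ 4      ≡⟨ cong (_^ℚ 4) cancel ⟩
  (+ χ / 1) ^ℚ 4                        ∎
  where
  open ℚ.≤-Reasoning
  open Exp (CommutativeRing.commutativeSemiring ℚ.+-*-commutativeRing) using (^-distrib-*)
  cancel : 1/48 ℚ.* (+ (48 * χ) / 1) ≡ + χ / 1
  cancel = trans (cong (1/48 ℚ.*_) (/1-homo-* 48 χ))
    (trans (sym (ℚ.*-assoc 1/48 (+ 48 / 1) (+ χ / 1))) (ℚ.*-identityˡ (+ χ / 1)))

-- Assembly for an arbitrary number of vertices

hasseDiagram : ∀ n m → n ≤ suc m ^ 4 → suc m ^ 4 ≤ 16 * n →
  Σ[ G ∈ FiniteGraph ] (FiniteGraph.order G ≡ n × IsHasseDiagram G ×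
    (∃[ χ ] (IsChromaticNumber G χ × n ≤ (48 * χ) ^ 4)))
hasseDiagram n m n≤m⁴ m⁴≤16n = G , refl , incidenceGraph-isHasseDiagram f , χ , isχ ,
  order≤χ⁴ {n} {χ} m m⁴≤16n n≤m⁴
    (vertices≤ f f-injective {χ} (IsChromaticNumber.colourable isχ))
  where
  f : Fin n → Incidence (suc m)
  -- The first `n` incidences of an enumeration serve as vertices; the counting bound holds for any
  -- injective choice.
  f v = to (Fin⁴↔Incidence (suc m)) (inject≤ v n≤m⁴)

  f-injective : Injective _≡_ _≡_ f
  f-injective eq = inject≤-injective n≤m⁴ n≤m⁴ _ _ (↔⇒injective (Fin⁴↔Incidence (suc m)) eq)

  G : FiniteGraph
  G = incidenceGraph f

  χ : ℕ
  χ = proj₁ (chromaticNumber G (incidenceGraph-adj? f))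

  isχ : IsChromaticNumber G χ
  isχ = proj₂ (chromaticNumber G (incidenceGraph-adj? f))

theorem1 : Σ[ c ∈ ℚ ] (0ℚ < c ×
    ((n : ℕ) → .{{_ : NonZero n}} →
    Σ[ G ∈ FiniteGraph ]
    (FiniteGraph.order G ≡ n ×
    IsHasseDiagram G ×
    (∃[ χ ] (IsChromaticNumber G χ × c · n ^¼≤ χ)))))
theorem1 = 1/48 , ℚ.positive⁻¹ 1/48 , λ n →
  let (m , n≤m⁴ , m⁴≤16n) = near-fourth-power n
      (G , order≡n , isHasse , χ , isχ , n≤) = hasseDiagram n m n≤m⁴ m⁴≤16n
  in G , order≡n , isHasse , χ , isχ , order≤⇒^¼≤ {n} {χ} n≤
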